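{- There exists a cap set $A \subseteq \mathbb{F}_3^{396}$ of size \[\binom{11}{7} \cdot 6^4 \cdot 12^4 \cdot 112^{62}.\]
   Context: A cap set is a set $A \subseteq \mathbb{F}_3^n$ such that the only solutions of $x+y+z=0$ with $x,y,z\in A$ are those with $x=y=z$. -}

module Defs where

open import Data.Fin.Base using (Fin; zero; toℕ)
open import Data.List.Base using (length)
import Data.List.Membership.Propositional as List
open import Data.List.Relation.Unary.Unique.Propositional using (Unique)
open import Data.Nat.Base using (ℕ; _+_)
open import Data.Nat.DivMod using (_mod_)
open import Data.Product.Base using (_×_; ∃-syntax)
open import Data.Vec.Base using (Vec; replicate; zipWith)
open import Function.Bundles using (_⇔_)
open import Level using (0ℓ)
open import Relation.Binary.PropositionalEquality.Core using (_≡_)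
open import Relation.Unary using (Pred; _∈_)

infixl 6 _+₃_ _⊕_

-- Only the additive structure of the field with three elements is involved
-- in the definition of a cap set, so multiplication is omitted.
𝔽₃ : Set
𝔽₃ = Fin 3

_+₃_ : 𝔽₃ → 𝔽₃ → 𝔽₃
x +₃ y = (toℕ x + toℕ y) mod 3

𝔽₃^_ : ℕ → Set
𝔽₃^ n = Vec 𝔽₃ n

_⊕_ : ∀ {n} → 𝔽₃^ n → 𝔽₃^ n → 𝔽₃^ n
_⊕_ = zipWith _+₃_

𝟎 : ∀ {n} → 𝔽₃^ n
𝟎 {n} = replicate n zero

-- The converse direction (x + x + x = 0) holds identically in 𝔽₃^ n.
IsCapSet : ∀ {n} → Pred (𝔽₃^ n) 0ℓ → Set
IsCapSet {n} A = ∀ (x y z : 𝔽₃^ n) → x ∈ A → y ∈ A → z ∈ A →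
                 x ⊕ y ⊕ z ≡ 𝟎 → x ≡ y × y ≡ z

-- Cardinality via a duplicate-free enumeration: unlike a bijection between
-- Fin N and the Σ-type of A, this does not count distinct membership proofs.
HasSize : ∀ {n} → Pred (𝔽₃^ n) 0ℓ → ℕ → Set
HasSize {n} A N = ∃[ xs ] Unique xs
                        × (∀ (x : 𝔽₃^ n) → x ∈ A ⇔ x List.∈ xs)
                        × length xs ≡ N

{-# OPTIONS --safe #-}

-- A family of codes F : Fin p → List (Vec (Fin q) k) refines a ternary
-- relation N on its p labels, relative to a ternary relation R on its q
-- digits, when any x, y, z in F a, F b, F c that are related digitwise by R
-- force N a b c, and moreover x = y = z if a = b = c. Refinements compose:
-- replace every letter of a codeword by the words of the code it names. A cap
-- set is a single code refining the relation "sum zero" on 𝔽₃. It is composed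
-- of
--   * Edel's family in 𝔽₃⁶ of codes of sizes 12, 112, 112, which refines the
--     relation "not separated" on {0,1,2};
--   * the family of words of length 6 consisting of a tournament code (one
--     zero in each word) and two constant words, refining the same relation;
--   * an admissible set in {0,1,2}¹¹ with one word for each support of size 7.
-- The last is a shortening of an admissible set in {0,1,2}¹² invariant under
-- rotating each of four blocks of three coordinates, which is thus itself
-- composed of a code of length 4 over seven rotation classes.
module Submission where

open import Data.Bool.Base using (Bool; true; false; T; _∧_; _∨_; not; if_then_else_)
open import Data.Bool.ListAction using (all)
open import Data.Bool.Properties using (T-∧; T-∨)
open import Data.Fin.Base using (Fin)
open import Data.Fin.Patterns
import Data.Fin.Properties as Fin
open import Data.List.Base using (List; []; _∷_; _++_; [_]; allFin; cartesianProductWith;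
  concatMap; length; map; tabulate)
open import Data.List.Membership.Propositional using (_∈_; lose)
open import Data.List.Membership.Propositional.Properties
  using (∈-allFin; ∈-cartesianProductWith⁻; ∈-concatMap⁺; ∈-++⁻)
open import Data.List.Properties using (length-++; length-map)
open import Data.List.Relation.Binary.Disjoint.Propositional using (Disjoint)
import Data.List.Relation.Unary.All as All
import Data.List.Relation.Unary.All.Properties as All
open import Data.List.Relation.Unary.AllPairs using ([]; _∷_)
open import Data.List.Relation.Unary.Any using (here; there)
open import Data.List.Relation.Unary.Unique.Propositional using (Unique)
import Data.List.Relation.Unary.Unique.Propositional.Properties as Unique
open import Data.Nat.Base using (ℕ; zero; suc; _+_; _*_; _^_)
open import Data.Nat.Combinatorics using (_C_)
open import Data.Nat.ListAction using (sum)
open import Data.Product.Base using (_×_; _,_; proj₁; proj₂; ∃-syntax)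
open import Data.Sum.Base using (inj₁; inj₂)
open import Data.Unit.Base using (⊤; tt)
open import Data.Vec.Base as Vec using (Vec; []; _∷_)
import Data.Vec.Properties as Vec
open import Function.Base using (_∘_; id)
open import Function.Bundles using (Equivalence; mk⇔)
open import Relation.Binary.PropositionalEquality
  using (_≡_; refl; sym; trans; cong; cong₂; subst)
open import Relation.Nullary.Decidable using (does; yes; no; ⌊_⌋; fromWitness; toWitness)
open import Relation.Nullary.Negation using (¬_; contradiction)
open import Defs

-- Ternary relations and codes that refine them

-- A truth table rather than a function, so that type checking evaluates each
-- entry only once.
Relation₃ : ℕ → Set
Relation₃ q = Vec (Vec (Vec Bool q) q) q

relation : ∀ {q} → (Fin q → Fin q → Fin q → Bool) → Relation₃ q
relation f = Vec.tabulate λ a → Vec.tabulate λ b → Vec.tabulate λ c → f a b c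

related : ∀ {q} → Relation₃ q → (a b c : Fin q) → Bool
related R a b c = Vec.lookup (Vec.lookup (Vec.lookup R a) b) c

related-relation : ∀ {q} (f : Fin q → Fin q → Fin q → Bool) a b c →
                   related (relation f) a b c ≡ f a b c
related-relation f a b c
  rewrite Vec.lookup∘tabulate (λ a → Vec.tabulate λ b → Vec.tabulate λ c → f a b c) a
        | Vec.lookup∘tabulate (λ b → Vec.tabulate λ c → f a b c) b
  = Vec.lookup∘tabulate (f a b) c

Code : ℕ → ℕ → Set
Code q n = List (Vec (Fin q) n)

Reflexive₃ : ∀ {q} → Relation₃ q → Set
Reflexive₃ R = ∀ a → T (related R a a a)

infixr 5 _∷_

data Digitwise {q} (R : Relation₃ q) : ∀ {n} → (x y z : Vec (Fin q) n) → Set where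
  []  : Digitwise R [] [] []
  _∷_ : ∀ {n a b c} {x y z : Vec (Fin q) n} → T (related R a b c) →
        Digitwise R x y z → Digitwise R (a ∷ x) (b ∷ y) (c ∷ z)

record Refines {p q k} (N : Relation₃ p) (R : Relation₃ q) (F : Fin p → Code q k) : Set where
  field
    labels : ∀ {a b c x y z} → x ∈ F a → y ∈ F b → z ∈ F c →
             Digitwise R x y z → T (related N a b c)
    equal  : ∀ {a x y z} → x ∈ F a → y ∈ F a → z ∈ F a →
             Digitwise R x y z → x ≡ y × y ≡ z

open Refines

module _ {q} {R : Relation₃ q} where

  digitwise-diagonal : Reflexive₃ R → ∀ {n} (x : Vec (Fin q) n) → Digitwise R x x x
  digitwise-diagonal r []      = []
  digitwise-diagonal r (a ∷ x) = r a ∷ digitwise-diagonal r x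

  digitwise-split : ∀ {m n} (x y z : Vec (Fin q) m) {x′ y′ z′ : Vec (Fin q) n} →
                    Digitwise R (x Vec.++ x′) (y Vec.++ y′) (z Vec.++ z′) →
                    Digitwise R x y z × Digitwise R x′ y′ z′
  digitwise-split []      []      []      d       = [] , d
  digitwise-split (_ ∷ x) (_ ∷ y) (_ ∷ z) (r ∷ d) =
    let d₁ , d₂ = digitwise-split x y z d in r ∷ d₁ , d₂

-- Composition of codes

expand : ∀ {p q k m} → (Fin p → Code q k) → Vec (Fin p) m → Code q (m * k)
expand F []      = [ [] ]
expand F (a ∷ w) = cartesianProductWith Vec._++_ (F a) (expand F w)

substitute : ∀ {p q k m} → (Fin p → Code q k) → Code p m → Code q (m * k)
substitute F K = concatMap (expand F) K

∈-substitute⁻ : ∀ {p q k m} {F : Fin p → Code q k} (K : Code p m) {x} →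
                x ∈ substitute F K → ∃[ w ] w ∈ K × x ∈ expand F w
∈-substitute⁻ {F = F} (w ∷ K) x∈ with ∈-++⁻ (expand F w) x∈
... | inj₁ x∈w = w , here refl , x∈w
... | inj₂ x∈K = let u , u∈K , x∈u = ∈-substitute⁻ K x∈K in u , there u∈K , x∈u

module _ {p q k} {N : Relation₃ p} {R : Relation₃ q} {F : Fin p → Code q k}
         (refines : Refines N R F) where

  expand-labels : ∀ {m} (u v w : Vec (Fin p) m) {x y z} →
                  x ∈ expand F u → y ∈ expand F v → z ∈ expand F w →
                  Digitwise R x y z → Digitwise N u v w
  expand-labels [] [] [] _ _ _ _ = []
  expand-labels (a ∷ u) (b ∷ v) (c ∷ w) x∈ y∈ z∈ d
    with x , _ , x∈a , x′∈u , refl ← ∈-cartesianProductWith⁻ Vec._++_ (F a) (expand F u) x∈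
       | y , _ , y∈b , y′∈v , refl ← ∈-cartesianProductWith⁻ Vec._++_ (F b) (expand F v) y∈
       | z , _ , z∈c , z′∈w , refl ← ∈-cartesianProductWith⁻ Vec._++_ (F c) (expand F w) z∈
    = let d₁ , d₂ = digitwise-split x y z d in
      labels refines x∈a y∈b z∈c d₁ ∷ expand-labels u v w x′∈u y′∈v z′∈w d₂

  expand-equal : ∀ {m} (w : Vec (Fin p) m) {x y z} →
                 x ∈ expand F w → y ∈ expand F w → z ∈ expand F w →
                 Digitwise R x y z → x ≡ y × y ≡ z
  expand-equal [] (here refl) (here refl) (here refl) _ = refl , refl
  expand-equal (a ∷ w) x∈ y∈ z∈ d
    with x , _ , x∈a , x′∈w , refl ← ∈-cartesianProductWith⁻ Vec._++_ (F a) (expand F w) x∈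
       | y , _ , y∈a , y′∈w , refl ← ∈-cartesianProductWith⁻ Vec._++_ (F a) (expand F w) y∈
       | z , _ , z∈a , z′∈w , refl ← ∈-cartesianProductWith⁻ Vec._++_ (F a) (expand F w) z∈
    = let d₁ , d₂     = digitwise-split x y z d
          x≡y , y≡z   = equal refines x∈a y∈a z∈a d₁
          x≡y′ , y≡z′ = expand-equal w x′∈w y′∈w z′∈w d₂
      in cong₂ Vec._++_ x≡y x≡y′ , cong₂ Vec._++_ y≡z y≡z′

  -- By `expand-labels` the words naming related words are themselves related, so `refines′` applies
  -- to them; once it makes them equal, `expand-equal` finishes.
  substitute-refines : ∀ {r m} {M : Relation₃ r} {G : Fin r → Code p m} →
                       Refines M N G → Refines M R (substitute F ∘ G)
  substitute-refines {G = G} refines′ .labels {a} {b} {c} x∈ y∈ z∈ d =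
    let u , u∈ , x∈u = ∈-substitute⁻ (G a) x∈
        v , v∈ , y∈v = ∈-substitute⁻ (G b) y∈
        w , w∈ , z∈w = ∈-substitute⁻ (G c) z∈
    in labels refines′ u∈ v∈ w∈ (expand-labels u v w x∈u y∈v z∈w d)
  substitute-refines {G = G} refines′ .equal {a} x∈ y∈ z∈ d
    with u , u∈ , x∈u ← ∈-substitute⁻ (G a) x∈
       | v , v∈ , y∈v ← ∈-substitute⁻ (G a) y∈
       | w , w∈ , z∈w ← ∈-substitute⁻ (G a) z∈
    with refl , refl ← equal refines′ u∈ v∈ w∈ (expand-labels u v w x∈u y∈v z∈w d)
    = expand-equal u x∈u y∈v z∈w d

  expand-unique : (∀ a → Unique (F a)) → ∀ {m} (w : Vec (Fin p) m) → Unique (expand F w)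
  expand-unique unique []      = All.[] ∷ []
  expand-unique unique (a ∷ w) =
    Unique.cartesianProductWith⁺ Vec._++_ (Vec.++-injective _ _)
      (unique a) (expand-unique unique w)

  -- If x lies in expand F u and in expand F w, then (u , u , w) is related
  -- digitwise because (x , x , x) is, and so u ≡ w.
  substitute-unique : Reflexive₃ R → (∀ a → Unique (F a)) →
                      ∀ {r m} {M : Relation₃ r} {G : Fin r → Code p m} → Refines M N G →
                      (∀ a → Unique (G a)) → ∀ a → Unique (substitute F (G a))
  substitute-unique reflexive unique {G = G} refines′ unique′ a = go (G a) id (unique′ a)
    where
    go : ∀ K → (∀ {u} → u ∈ K → u ∈ G a) → Unique K → Unique (substitute F K)
    go []      K⊆G _             = []
    go (u ∷ K) K⊆G (u∉K ∷ K-unique) =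
      Unique.++⁺ (expand-unique unique u) (go K (K⊆G ∘ there) K-unique) disjoint
      where
      disjoint : Disjoint (expand F u) (substitute F K)
      disjoint {x} (x∈u , x∈K) =
        let w , w∈K , x∈w = ∈-substitute⁻ K x∈K
            d = expand-labels u u w x∈u x∈u x∈w (digitwise-diagonal reflexive x)
        in All.lookup u∉K w∈K
             (proj₂ (equal refines′ (K⊆G (here refl)) (K⊆G (here refl)) (K⊆G (there w∈K)) d))

length-cartesianProductWith : ∀ {A B D : Set} (f : A → B → D) xs ys →
  length (cartesianProductWith f xs ys) ≡ length xs * length ys
length-cartesianProductWith f []       ys = refl
length-cartesianProductWith f (x ∷ xs) ys =
  trans (length-++ (map (f x) ys))
        (cong₂ _+_ (length-map (f x) ys) (length-cartesianProductWith f xs ys))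

weight : ∀ {p m} → (Fin p → ℕ) → Vec (Fin p) m → ℕ
weight s []      = 1
weight s (a ∷ w) = s a * weight s w

totalWeight : ∀ {p m} → (Fin p → ℕ) → Code p m → ℕ
totalWeight s K = sum (map (weight s) K)

module _ {p q k} {F : Fin p → Code q k} {s : Fin p → ℕ} (sizes : ∀ a → length (F a) ≡ s a) where

  length-expand : ∀ {m} (w : Vec (Fin p) m) → length (expand F w) ≡ weight s w
  length-expand []      = refl
  length-expand (a ∷ w) =
    trans (length-cartesianProductWith Vec._++_ (F a) (expand F w))
          (cong₂ _*_ (sizes a) (length-expand w))

  length-substitute : ∀ {m} (K : Code p m) → length (substitute F K) ≡ totalWeight s K
  length-substitute []      = refl
  length-substitute (w ∷ K) =
    trans (length-++ (expand F w)) (cong₂ _+_ (length-expand w) (length-substitute K))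

-- Shortening of codes

branch : ∀ {q n} → Fin q → Code q (suc n) → Code q n
branch a []            = []
branch a ((b ∷ w) ∷ K) = if does (a Fin.≟ b) then w ∷ branch a K else branch a K

∈-branch⁺ : ∀ {q n} (a : Fin q) {w : Vec (Fin q) n} K → (a ∷ w) ∈ K → w ∈ branch a K
∈-branch⁺ a ((b ∷ _) ∷ K) w∈ with a Fin.≟ b
∈-branch⁺ a ((b ∷ _) ∷ K) (here refl) | yes _   = here refl
∈-branch⁺ a ((b ∷ _) ∷ K) (there w∈)  | yes _   = there (∈-branch⁺ a K w∈)
∈-branch⁺ a ((b ∷ _) ∷ K) (here refl) | no  a≢a = contradiction refl a≢a
∈-branch⁺ a ((b ∷ _) ∷ K) (there w∈)  | no  _   = ∈-branch⁺ a K w∈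

∈-branch⁻ : ∀ {q n} (a : Fin q) {w : Vec (Fin q) n} K → w ∈ branch a K → (a ∷ w) ∈ K
∈-branch⁻ a ((b ∷ _) ∷ K) w∈ with a Fin.≟ b
∈-branch⁻ a ((b ∷ _) ∷ K) (here refl) | yes refl = here refl
∈-branch⁻ a ((b ∷ _) ∷ K) (there w∈)  | yes _    = there (∈-branch⁻ a K w∈)
∈-branch⁻ a ((b ∷ _) ∷ K) w∈          | no  _    = there (∈-branch⁻ a K w∈)

branch-unique : ∀ {q n} (a : Fin q) (K : Code q (suc n)) → Unique K → Unique (branch a K)
branch-unique a []            _                = []
branch-unique a ((b ∷ w) ∷ K) (w∉K ∷ K-unique) with a Fin.≟ b
... | no  _    = branch-unique a K K-unique
... | yes refl = All.tabulate (λ u∈ w≡u → All.lookup w∉K (∈-branch⁻ a K u∈) (cong (a ∷_) w≡u))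
                 ∷ branch-unique a K K-unique

-- Putting `a` back in front keeps three words related, since `a` is related to itself.
branch-refines : ∀ {p q k} {N : Relation₃ p} {R : Relation₃ q} {F : Fin p → Code q (suc k)} →
                 Reflexive₃ R → ∀ a → Refines N R F → Refines N R (branch a ∘ F)
branch-refines {F = F} reflexive a refines .labels {b} {c} {d} x∈ y∈ z∈ e =
  labels refines (∈-branch⁻ a (F b) x∈) (∈-branch⁻ a (F c) y∈) (∈-branch⁻ a (F d) z∈)
    (reflexive a ∷ e)
branch-refines {F = F} reflexive a refines .equal {b} x∈ y∈ z∈ e =
  let x≡y , y≡z = equal refines (∈-branch⁻ a (F b) x∈) (∈-branch⁻ a (F b) y∈)
                    (∈-branch⁻ a (F b) z∈) (reflexive a ∷ e)
  in Vec.∷-injectiveʳ x≡y , Vec.∷-injectiveʳ y≡z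

-- Decision by depth-first search

-- Only nonempty branches are stored.
Trie : ℕ → ℕ → Set
Trie q zero    = ⊤
Trie q (suc n) = List (Fin q × Trie q n)

trie : ∀ {q} n → Code q n → Trie q n
trie         zero    K = tt
trie {q = q} (suc n) K = concatMap (λ a → fork a (branch a K)) (allFin q)
  module Forks where
  fork : Fin q → Code q n → Trie q (suc n)
  fork a []         = []
  fork a K@(_ ∷ _) = [ a , trie n K ]

∈-trie : ∀ {q n} {a : Fin q} {w : Vec (Fin q) n} K → (a ∷ w) ∈ K →
         (a , trie n (branch a K)) ∈ trie (suc n) K
∈-trie {q} {n} {a} K aw∈K = ∈-concatMap⁺ _ (lose (∈-allFin a) (∈-fork (∈-branch⁺ a K aw∈K)))
  where
  ∈-fork : ∀ {L} {w : Vec (Fin q) n} → w ∈ L → (a , trie n L) ∈ Forks.fork n K a L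
  ∈-fork {_ ∷ _} _ = here refl

-- The flag e says whether a triple is still admissible: initially whether
-- x = y = z is tolerated, later also that the prefixes read so far coincide.
search : ∀ {q} n → Relation₃ q → Bool → (X Y Z : Trie q n) → Bool
search zero    R e X Y Z = e
search (suc n) R e X Y Z =
  all (λ (a , x) → all (λ (b , y) → all (λ (c , z) →
    not (related R a b c) ∨ search n R (e ∧ (⌊ a Fin.≟ b ⌋ ∧ ⌊ b Fin.≟ c ⌋)) x y z) Z) Y) X

-- id R is a shared thunk, whereas a named table R would be recomputed at every
-- lookup.
check : ∀ {q n} → Relation₃ q → Bool → (X Y Z : Code q n) → Bool
check {n = n} R e X Y Z = search n (id R) e (trie n X) (trie n Y) (trie n Z)

all-sound : ∀ {A : Set} {p : A → Bool} {xs x} → T (all p xs) → x ∈ xs → T (p x)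
all-sound {p = p} {xs} t = All.lookup (All.all⁺ p xs t)

check-sound : ∀ {q n} {R : Relation₃ q} e {X Y Z : Code q n} {x y z} → T (check R e X Y Z) →
              x ∈ X → y ∈ Y → z ∈ Z → Digitwise R x y z → T e × x ≡ y × y ≡ z
check-sound e t x∈ y∈ z∈ [] = t , refl , refl
check-sound {R = R} e {X} {Y} {Z} t x∈ y∈ z∈ (_∷_ {a = a} {b} {c} r d)
  -- Abstracting over the table entry lets the case `true` reduce the disjunction to the search one
  -- level down.
  with related R a b c | r
     | all-sound (all-sound (all-sound t (∈-trie X x∈)) (∈-trie Y y∈)) (∈-trie Z z∈)
... | true | _ | t₁
  with t₂ , refl , refl ← check-sound (e ∧ (⌊ a Fin.≟ b ⌋ ∧ ⌊ b Fin.≟ c ⌋)) t₁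
                            (∈-branch⁺ a X x∈) (∈-branch⁺ b Y y∈) (∈-branch⁺ c Z z∈) d
  with te , t₃ ← Equivalence.to T-∧ t₂
  with ta , tb ← Equivalence.to (T-∧ {⌊ a Fin.≟ b ⌋}) t₃
  with refl ← toWitness {a? = a Fin.≟ b} ta
  with refl ← toWitness {a? = b Fin.≟ c} tb
  = te , refl , refl

forAll : ∀ q → (Fin q → Bool) → Bool
forAll q p = all p (allFin q)

forAll-sound : ∀ {q} (p : Fin q → Bool) → T (forAll q p) → ∀ a → T (p a)
forAll-sound p t a = all-sound t (∈-allFin a)

-- With the flag `false` the search rejects every related triple, with `true` only those that are
-- not constant.
refines? : ∀ {p q k} → Relation₃ p → Relation₃ q → (Fin p → Code q k) → Bool
refines? {p} N R F =
  (forAll p λ a → forAll p λ b → forAll p λ c →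
    related N a b c ∨ check R false (F a) (F b) (F c)) ∧
  (forAll p λ a → check R true (F a) (F a) (F a))

refines?-sound : ∀ {p q k} {N : Relation₃ p} {R : Relation₃ q} {F : Fin p → Code q k} →
                 T (refines? N R F) → Refines N R F
refines?-sound {N = N} t .labels {a} {b} {c} x∈ y∈ z∈ d
  with Equivalence.to (T-∨ {related N a b c})
         (forAll-sound _ (forAll-sound _ (forAll-sound _ (proj₁ (Equivalence.to T-∧ t)) a) b) c)
... | inj₁ r  = r
... | inj₂ t′ = contradiction (proj₁ (check-sound false t′ x∈ y∈ z∈ d)) id
refines?-sound {p} t .equal {a} x∈ y∈ z∈ d =
  proj₂ (check-sound true (forAll-sound _ (proj₂ (Equivalence.to (T-∧ {forAll p _}) t)) a)
           x∈ y∈ z∈ d)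

-- Branching on the first letter avoids comparing all pairs of words.
unique? : ∀ {q n} → Code q n → Bool
unique? {n = zero}  []          = true
unique? {n = zero}  (_ ∷ [])    = true
unique? {n = zero}  (_ ∷ _ ∷ _) = false
unique? {q} {suc n} K           = forAll q λ a → unique? (branch a K)

unique-branches : ∀ {q n} (K : Code q (suc n)) → (∀ a → Unique (branch a K)) → Unique K
unique-branches []            _      = []
unique-branches ((b ∷ w) ∷ K) unique =
  All.tabulate (λ { u∈K refl → head-unique b (unique b) refl (∈-branch⁺ b K u∈K) })
  ∷ unique-branches K (λ a → tail-unique a (unique a))
  where
  head-unique : ∀ a → Unique (branch a ((b ∷ w) ∷ K)) → a ≡ b → ¬ w ∈ branch a K
  head-unique a u a≡b w∈ with a Fin.≟ b
  head-unique a (w∉ ∷ _) a≡b w∈ | yes _   = All.lookup w∉ w∈ refl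
  head-unique a u        a≡b w∈ | no  a≢b = a≢b a≡b

  tail-unique : ∀ a → Unique (branch a ((b ∷ w) ∷ K)) → Unique (branch a K)
  tail-unique a u       with a Fin.≟ b
  tail-unique a (_ ∷ u) | yes _ = u
  tail-unique a u       | no  _ = u

unique?-sound : ∀ {q n} (K : Code q n) → T (unique? K) → Unique K
unique?-sound {n = zero}  []       _ = []
unique?-sound {n = zero}  (_ ∷ []) _ = All.[] ∷ []
unique?-sound {q} {suc n} K        t = unique-branches K λ a →
  unique?-sound (branch a K) (forAll-sound _ t a)

-- Cap sets from admissible sets

sumsToZero : 𝔽₃ → 𝔽₃ → 𝔽₃ → Bool
sumsToZero a b c = ⌊ a +₃ b +₃ c Fin.≟ 0F ⌋

zeroSum : Relation₃ 3
zeroSum = relation sumsToZero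

zeroSum-reflexive : Reflexive₃ zeroSum
zeroSum-reflexive = forAll-sound _ tt

-- The separated triples are the permutations of (0,1,2), (0,0,1) and (0,0,2).
unseparated : Relation₃ 3
unseparated = relation λ a b c → not (separates a b c ∨ separates b a c ∨ separates c a b)
  where
  separates : (a b c : Fin 3) → Bool
  separates a b c = ⌊ a Fin.≟ 0F ⌋ ∧ not ⌊ b Fin.≟ c ⌋

unseparated-reflexive : Reflexive₃ unseparated
unseparated-reflexive = forAll-sound _ tt

-- For a single code, `equal` is the cap property relative to `zeroSum` and admissibility relative
-- to `unseparated`.
anything : Relation₃ 1
anything = relation λ _ _ _ → true

⊕-zeroSum : ∀ {n} (x y z : 𝔽₃^ n) → x ⊕ y ⊕ z ≡ 𝟎 → Digitwise zeroSum x y z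
⊕-zeroSum []      []      []      _  = []
⊕-zeroSum (a ∷ x) (b ∷ y) (c ∷ z) eq =
  subst T (sym (related-relation sumsToZero a b c)) (fromWitness (Vec.∷-injectiveˡ eq))
  ∷ ⊕-zeroSum x y z (Vec.∷-injectiveʳ eq)

substitute-capSet : ∀ {p k m} {N : Relation₃ p} {F : Fin p → Code 3 k} {K : Code p m}
                    {size : Fin p → ℕ} →
                    Refines N zeroSum F → (∀ a → Unique (F a)) →
                    (∀ a → length (F a) ≡ size a) →
                    Refines anything N (λ _ → K) → Unique K →
                    ∃[ A ] IsCapSet {m * k} A × HasSize A (totalWeight size K)
substitute-capSet {F = F} {K} refines unique sizes refines′ unique′ =
  (_∈ substitute F K) ,
  (λ x y z x∈ y∈ z∈ eq →
    equal (substitute-refines refines refines′) {0F} x∈ y∈ z∈ (⊕-zeroSum x y z eq)) ,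
  substitute F K ,
  substitute-unique refines zeroSum-reflexive unique refines′ (λ _ → unique′) 0F ,
  (λ _ → mk⇔ id id) ,
  length-substitute sizes K

-- Edel's family in dimension 6

-- The label tells whether the coordinate belongs to the support.
digits : Fin 2 → Code 3 1
digits 0F = (0F ∷ []) ∷ []
digits 1F = (1F ∷ []) ∷ (2F ∷ []) ∷ []

units : Code 2 6
units = tabulate λ i → Vec.tabulate λ j → if does (i Fin.≟ j) then 1F else 0F

-- A 2-(6,3,2) design and its complementary design.
design design′ : Code 2 6
design =
  (1F ∷ 1F ∷ 1F ∷ 0F ∷ 0F ∷ 0F ∷ []) ∷
  (1F ∷ 1F ∷ 0F ∷ 1F ∷ 0F ∷ 0F ∷ []) ∷
  (1F ∷ 0F ∷ 1F ∷ 0F ∷ 1F ∷ 0F ∷ []) ∷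
  (1F ∷ 0F ∷ 0F ∷ 1F ∷ 0F ∷ 1F ∷ []) ∷
  (1F ∷ 0F ∷ 0F ∷ 0F ∷ 1F ∷ 1F ∷ []) ∷
  (0F ∷ 1F ∷ 1F ∷ 0F ∷ 0F ∷ 1F ∷ []) ∷
  (0F ∷ 1F ∷ 0F ∷ 1F ∷ 1F ∷ 0F ∷ []) ∷
  (0F ∷ 1F ∷ 0F ∷ 0F ∷ 1F ∷ 1F ∷ []) ∷
  (0F ∷ 0F ∷ 1F ∷ 1F ∷ 1F ∷ 0F ∷ []) ∷
  (0F ∷ 0F ∷ 1F ∷ 1F ∷ 0F ∷ 1F ∷ []) ∷ []
design′ =
  (1F ∷ 1F ∷ 0F ∷ 0F ∷ 1F ∷ 0F ∷ []) ∷
  (1F ∷ 1F ∷ 0F ∷ 0F ∷ 0F ∷ 1F ∷ []) ∷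
  (1F ∷ 0F ∷ 1F ∷ 1F ∷ 0F ∷ 0F ∷ []) ∷
  (1F ∷ 0F ∷ 1F ∷ 0F ∷ 0F ∷ 1F ∷ []) ∷
  (1F ∷ 0F ∷ 0F ∷ 1F ∷ 1F ∷ 0F ∷ []) ∷
  (0F ∷ 1F ∷ 1F ∷ 1F ∷ 0F ∷ 0F ∷ []) ∷
  (0F ∷ 1F ∷ 1F ∷ 0F ∷ 1F ∷ 0F ∷ []) ∷
  (0F ∷ 1F ∷ 0F ∷ 1F ∷ 0F ∷ 1F ∷ []) ∷
  (0F ∷ 0F ∷ 1F ∷ 0F ∷ 1F ∷ 1F ∷ []) ∷
  (0F ∷ 0F ∷ 0F ∷ 1F ∷ 1F ∷ 1F ∷ []) ∷ []

-- Vectors of full support with an even number of digits 2, obtained from pairs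
-- of digits and the parity code of length 3.
pairs : Fin 2 → Code 3 2
pairs 0F = (1F ∷ 1F ∷ []) ∷ (2F ∷ 2F ∷ []) ∷ []
pairs 1F = (1F ∷ 2F ∷ []) ∷ (2F ∷ 1F ∷ []) ∷ []

even : Code 3 6
even = substitute pairs
  ((0F ∷ 0F ∷ 0F ∷ []) ∷ (0F ∷ 1F ∷ 1F ∷ []) ∷ (1F ∷ 0F ∷ 1F ∷ []) ∷ (1F ∷ 1F ∷ 0F ∷ []) ∷ [])

edel : Fin 3 → Code 3 6
edel 0F = substitute digits units
edel 1F = substitute digits design ++ even
edel 2F = substitute digits design′ ++ even

-- For separated labels: two words of weight 1 sum to weight at most 2, while the other codes have
-- weights 3 and 6. Labels 0, 1, 2 would need supports differing in at most one place, hence two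
-- even words; parity forbids a sum of weight 1.
edel-refines : Refines unseparated zeroSum edel
edel-refines = refines?-sound tt

edel-unique : ∀ a → Unique (edel a)
edel-unique 0F = unique?-sound (edel 0F) tt
edel-unique 1F = unique?-sound (edel 1F) tt
edel-unique 2F = unique?-sound (edel 2F) tt

-- Here 12 is `6 * 2`, and 112 is `10 * 2 ^ 3` from a design plus 32 even words.
edel-size : Fin 3 → ℕ
edel-size 0F = 12
edel-size 1F = 112
edel-size 2F = 112

edel-length : ∀ a → length (edel a) ≡ edel-size a
edel-length 0F = refl
edel-length 1F = refl
edel-length 2F = refl

-- The tournament family

tournament : Fin 3 → Code 3 6
tournament 0F = tabulate λ i → Vec.tabulate λ j →
  if does (i Fin.≟ j) then 0F else if does (i Fin.<? j) then 1F else 2F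
tournament 1F = [ Vec.replicate 6 1F ]
tournament 2F = [ Vec.replicate 6 2F ]

-- For `i < j`, words `i` and `j` read 0, 2 at place `i` and 1, 0 at place `j`: the former separates
-- them from the constant word 1, the latter from 2. Of three distinct words, the zero of the middle
-- one meets 1 and 2.
tournament-refines : Refines unseparated unseparated tournament
tournament-refines = refines?-sound tt

tournament-unique : ∀ a → Unique (tournament a)
tournament-unique 0F = unique?-sound (tournament 0F) tt
tournament-unique 1F = unique?-sound (tournament 1F) tt
tournament-unique 2F = unique?-sound (tournament 2F) tt

-- The admissible set of length 11 and weight 7

rotations : Fin 7 → Code 3 3
rotations 0F = (0F ∷ 0F ∷ 0F ∷ []) ∷ []
rotations 1F = (1F ∷ 1F ∷ 1F ∷ []) ∷ []
rotations 2F = (2F ∷ 2F ∷ 2F ∷ []) ∷ []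
rotations 3F = (0F ∷ 0F ∷ 1F ∷ []) ∷ (0F ∷ 1F ∷ 0F ∷ []) ∷ (1F ∷ 0F ∷ 0F ∷ []) ∷ []
rotations 4F = (0F ∷ 0F ∷ 2F ∷ []) ∷ (0F ∷ 2F ∷ 0F ∷ []) ∷ (2F ∷ 0F ∷ 0F ∷ []) ∷ []
rotations 5F = (0F ∷ 1F ∷ 2F ∷ []) ∷ (1F ∷ 2F ∷ 0F ∷ []) ∷ (2F ∷ 0F ∷ 1F ∷ []) ∷ []
rotations 6F = (0F ∷ 2F ∷ 1F ∷ []) ∷ (1F ∷ 0F ∷ 2F ∷ []) ∷ (2F ∷ 1F ∷ 0F ∷ []) ∷ []

-- The smallest relation for which `rotations` satisfies `labels`.
letters : Relation₃ 7
letters = relation λ a b c →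
  not (check unseparated false (rotations a) (rotations b) (rotations c))

-- Found by local search. The words are determined up to the choice between the
-- two rotation classes with the same number of nonzero digits, by listing the
-- supports of weight 7 up to rotation of the blocks. Words with first letter 1
-- or 2 are omitted, since they do not survive the shortening.
word-code : Code 7 4
word-code =
  (0F ∷ 1F ∷ 4F ∷ 2F ∷ []) ∷ (0F ∷ 1F ∷ 5F ∷ 5F ∷ []) ∷
  (0F ∷ 2F ∷ 1F ∷ 3F ∷ []) ∷ (0F ∷ 4F ∷ 2F ∷ 1F ∷ []) ∷
  (0F ∷ 6F ∷ 1F ∷ 6F ∷ []) ∷ (0F ∷ 6F ∷ 6F ∷ 1F ∷ []) ∷
  (3F ∷ 0F ∷ 2F ∷ 1F ∷ []) ∷ (3F ∷ 1F ∷ 1F ∷ 0F ∷ []) ∷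
  (3F ∷ 2F ∷ 0F ∷ 1F ∷ []) ∷ (3F ∷ 3F ∷ 5F ∷ 1F ∷ []) ∷
  (3F ∷ 5F ∷ 4F ∷ 2F ∷ []) ∷ (3F ∷ 5F ∷ 5F ∷ 5F ∷ []) ∷
  (4F ∷ 1F ∷ 3F ∷ 6F ∷ []) ∷ (4F ∷ 2F ∷ 6F ∷ 3F ∷ []) ∷
  (4F ∷ 4F ∷ 1F ∷ 5F ∷ []) ∷ (4F ∷ 6F ∷ 2F ∷ 3F ∷ []) ∷
  (5F ∷ 0F ∷ 6F ∷ 2F ∷ []) ∷ (5F ∷ 2F ∷ 4F ∷ 3F ∷ []) ∷
  (5F ∷ 3F ∷ 4F ∷ 2F ∷ []) ∷ (5F ∷ 3F ∷ 5F ∷ 6F ∷ []) ∷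
  (5F ∷ 5F ∷ 5F ∷ 3F ∷ []) ∷ (5F ∷ 6F ∷ 3F ∷ 6F ∷ []) ∷
  (6F ∷ 0F ∷ 2F ∷ 6F ∷ []) ∷ (6F ∷ 1F ∷ 6F ∷ 0F ∷ []) ∷
  (6F ∷ 2F ∷ 0F ∷ 6F ∷ []) ∷ (6F ∷ 4F ∷ 1F ∷ 3F ∷ []) ∷
  (6F ∷ 5F ∷ 0F ∷ 2F ∷ []) ∷ (6F ∷ 5F ∷ 2F ∷ 0F ∷ []) ∷ []

rotations-refines : Refines letters unseparated rotations
rotations-refines = refines?-sound tt

rotations-unique : ∀ a → Unique (rotations a)
rotations-unique a = unique?-sound (rotations a) (forAll-sound (unique? ∘ rotations) tt a)

word-refines : Refines anything letters (λ _ → word-code)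
word-refines = refines?-sound tt

-- Shortening at a zero preserves the weight 7 and lowers the length from 12 to 11.
unshortened admissible : Code 3 _
unshortened = substitute rotations word-code
admissible  = branch 0F unshortened

admissible-refines : Refines anything unseparated (λ _ → admissible)
admissible-refines = branch-refines unseparated-reflexive 0F
  (substitute-refines rotations-refines word-refines)

admissible-unique : Unique admissible
admissible-unique = branch-unique 0F unshortened
  (substitute-unique rotations-refines unseparated-reflexive
    rotations-unique word-refines (λ _ → unique?-sound word-code tt) 0F)

-- The cap set in dimension 396

block : Fin 3 → Code 3 36
block = substitute edel ∘ tournament

block-refines : Refines unseparated zeroSum block
block-refines = substitute-refines edel-refines tournament-refines

block-unique : ∀ a → Unique (block a)
block-unique = substitute-unique edel-refines zeroSum-reflexive edel-unique
  tournament-refines tournament-unique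

block-size : Fin 3 → ℕ
block-size 0F = 6 * 12 * 112 ^ 5
block-size 1F = 112 ^ 6
block-size 2F = 112 ^ 6

-- For a concrete label in place of a, conversion would enumerate block a.
block-length : ∀ a → length (block a) ≡ block-size a
block-length a = trans (length-substitute edel-length (tournament a)) (weights a)
  where
  weights : ∀ a → totalWeight edel-size (tournament a) ≡ block-size a
  weights 0F = refl
  weights 1F = refl
  weights 2F = refl

theorem2p15 : ∃[ A ] IsCapSet {396} A × HasSize A ((11 C 7) * 6 ^ 4 * 12 ^ 4 * 112 ^ 62)
theorem2p15 =
  -- The dimension is `11 * 36`. Each of the `11 C 7` admissible words has four zeros and seven
  -- other digits, so 112 gets the exponent `4 * 5 + 7 * 6`.
  substitute-capSet block-refines block-unique block-length admissible-refines admissible-unique
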